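{- Let $G$ be a finite simple graph. Then $G$ has an opposition if and only if the complement $\overline{G}$ has an opposition matching.
   Context: All graphs are finite and simple. $N[v]$ denotes the closed neighbourhood of $v$ (the vertex $v$ together with its neighbours). An opposition of a graph $G$ is an automorphism $f$ of $G$ of order two, in the sense $f\circ f=\mathrm{id}$, such that $f(v)\notin N[v]$ for all $v\in V(G)$ (so the empty graph vacuously has an opposition). A perfect matching $M$ of a graph $K$ is an opposition matching if for any two distinct edges $v_1v_2\neq v_3v_4$ in $M$, the subgraph of $K$ induced by $\{v_1,v_2,v_3,v_4\}$ is isomorphic to $K_4$, or isomorphic to $C_4$, or consists of just the two edges $v_1v_2$ and $v_3v_4$ of $M$. -}

module Defs where

open import Level using (0ℓ)
open import Data.Nat.Base as ℕ using (ℕ; _%_)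
import Data.Nat.Properties as ℕ
open import Data.Fin.Base using (Fin; toℕ)
open import Data.Fin.Properties using (_≟_; all?)
open import Data.Fin.Subset using (Subset; ⁅_⁆; _∪_) renaming (_∈_ to _∈ˢ_)
open import Data.Product.Base using (_×_; _,_; ∃-syntax; proj₁)
open import Data.Product using (∃!)
open import Data.Sum.Base using (_⊎_; swap)
open import Function.Base using (_on_; _∘_)
open import Function.Bundles using (_↔_; _⇔_; Inverse)
open import Relation.Binary.Core using (Rel; _⇒_)
open import Relation.Binary.Definitions
  using (Symmetric; Irreflexive; Decidable)
open import Relation.Binary.PropositionalEquality.Core
  using (_≡_; _≢_; refl; ≢-sym)
open import Relation.Nullary.Decidable using (from-yes; ¬?; _×-dec_; _⊎-dec_)
open import Relation.Nullary.Negation using (¬_)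
open import Relation.Unary using (Pred; _∉_)

-- Finiteness is imposed by the choice of vertex type: a finite simple graph
-- of order n is a SimpleGraph (Fin n).
record SimpleGraph (V : Set) : Set₁ where
  field
    Adj    : Rel V 0ℓ
    symm   : Symmetric Adj
    irrefl : Irreflexive _≡_ Adj
    adj?   : Decidable Adj

  N[_] : V → Pred V 0ℓ
  N[ v ] u = u ≡ v ⊎ Adj v u

open SimpleGraph

infix 4 _≅_

record _≅_ {V W : Set} (G : SimpleGraph V) (H : SimpleGraph W) : Set where
  field
    bijection : V ↔ W

  open Inverse bijection public using (to; from)

  field
    preserves : ∀ u v → Adj G u v ⇔ Adj H (to u) (to v)

complement : ∀ {n} → SimpleGraph (Fin n) → SimpleGraph (Fin n)
complement G = record
  { Adj    = λ u v → u ≢ v × ¬ Adj G u v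
  ; symm   = λ (u≢v , ¬uv) → ≢-sym u≢v , ¬uv ∘ symm G
  ; irrefl = λ u≡v (u≢v , _) → u≢v u≡v
  ; adj?   = λ u v → ¬? (u ≟ v) ×-dec ¬? (adj? G u v)
  }

-- Membership in a Subset is proof-irrelevant, so the vertex type has exactly
-- one element for each element of S.
induced : ∀ {n} → SimpleGraph (Fin n) → (S : Subset n) →
          SimpleGraph (∃[ v ] v ∈ˢ S)
induced G S = record
  { Adj    = Adj G on proj₁
  ; symm   = symm G
  ; irrefl = λ { refl → irrefl G refl }
  ; adj?   = λ u v → adj? G (proj₁ u) (proj₁ v)
  }

K₄ : SimpleGraph (Fin 4)
K₄ = record
  { Adj    = _≢_
  ; symm   = ≢-sym
  ; irrefl = λ u≡v u≢v → u≢v u≡v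
  ; adj?   = λ u v → ¬? (u ≟ v)
  }

-- i ↝ j says j = i + 1 modulo 4.
_↝_ : Rel (Fin 4) 0ℓ
i ↝ j = ℕ.suc (toℕ i) % 4 ≡ toℕ j

C₄ : SimpleGraph (Fin 4)
C₄ = record
  { Adj    = λ i j → i ↝ j ⊎ j ↝ i
  ; symm   = swap
  ; irrefl = λ { {i} refl → from-yes (all? (λ k → ¬? (adj?′ k k))) i }
  ; adj?   = adj?′
  }
  where
  adj?′ : Decidable (λ i j → i ↝ j ⊎ j ↝ i)
  adj?′ i j = (ℕ.suc (toℕ i) % 4 ℕ.≟ toℕ j) ⊎-dec (ℕ.suc (toℕ j) % 4 ℕ.≟ toℕ i)

record IsOpposition {V : Set} (G : SimpleGraph V) (f : G ≅ G) : Set where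
  open _≅_ f using (to)
  field
    involutive : ∀ v → to (to v) ≡ v
    opposed    : ∀ v → to v ∉ N[_] G v

HasOpposition : ∀ {V} → SimpleGraph V → Set
HasOpposition G = ∃[ f ] IsOpposition G f

-- Equality of the unordered pairs {u , v} and {x , y}.
SameEdge : {V : Set} → V × V → V × V → Set
SameEdge (u , v) (x , y) = (u ≡ x × v ≡ y) ⊎ (u ≡ y × v ≡ x)

-- A set of edges is a symmetric relation M contained in adjacency, with M u v
-- meaning that the edge uv belongs to the set. It is a perfect matching when
-- every vertex lies on exactly one of its edges (M is then decidable).
record IsPerfectMatching {V : Set} (K : SimpleGraph V) (M : Rel V 0ℓ) : Set where
  field
    symmetric : Symmetric M
    edges     : M ⇒ Adj K
    matched   : ∀ v → ∃! _≡_ (M v)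

module _ {n : ℕ} (K : SimpleGraph (Fin n)) where

  inducedBy4 : (v₁ v₂ v₃ v₄ : Fin n) →
               SimpleGraph (∃[ v ] v ∈ˢ (⁅ v₁ ⁆ ∪ ⁅ v₂ ⁆ ∪ ⁅ v₃ ⁆ ∪ ⁅ v₄ ⁆))
  inducedBy4 v₁ v₂ v₃ v₄ = induced K (⁅ v₁ ⁆ ∪ ⁅ v₂ ⁆ ∪ ⁅ v₃ ⁆ ∪ ⁅ v₄ ⁆)

  OnlyTwoEdges : (v₁ v₂ v₃ v₄ : Fin n) → Set
  OnlyTwoEdges v₁ v₂ v₃ v₄ = ∀ x y →
    Adj (inducedBy4 v₁ v₂ v₃ v₄) x y ⇔
      (SameEdge (proj₁ x , proj₁ y) (v₁ , v₂) ⊎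
       SameEdge (proj₁ x , proj₁ y) (v₃ , v₄))

  record IsOppositionMatching (M : Rel (Fin n) 0ℓ) : Set where
    field
      isPerfectMatching : IsPerfectMatching K M
      pairs : ∀ v₁ v₂ v₃ v₄ → M v₁ v₂ → M v₃ v₄ →
              ¬ SameEdge (v₁ , v₂) (v₃ , v₄) →
              inducedBy4 v₁ v₂ v₃ v₄ ≅ K₄
              ⊎ inducedBy4 v₁ v₂ v₃ v₄ ≅ C₄
              ⊎ OnlyTwoEdges v₁ v₂ v₃ v₄

  HasOppositionMatching : Set₁
  HasOppositionMatching = ∃[ M ] IsOppositionMatching M

{-# OPTIONS --safe #-}

-- An opposition f of G and an opposition matching M of the complement K
-- determine each other by M = { v f(v) }.  For two edges v₁v₂ and v₃v₄ of M,
-- f swaps the possible cross edges v₁v₃ ↔ v₂v₄ and v₁v₄ ↔ v₂v₃ of K: both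
-- pairs present gives K₄, exactly one gives C₄, none leaves the two edges
-- alone.  Conversely, in K₄, in C₄ and in 2K₂ the two matching edges always
-- satisfy v₁v₃ ∈ K ⇒ v₂v₄ ∈ K, which is what makes f an automorphism.
module Submission where

open import Defs
open import Data.Empty using (⊥-elim)
open import Data.Nat.Base using (ℕ; s<s)
open import Data.Fin.Base using (Fin; _<_)
open import Data.Fin.Patterns using (0F; 1F; 2F; 3F)
open import Data.Fin.Properties using (_≟_; all?; <-cmp)
open import Data.Fin.Subset using (Subset; ⁅_⁆; _∪_) renaming (_∈_ to _∈ˢ_)
open import Data.Fin.Subset.Properties using (∪⇔⊎; x∈⁅y⁆⇔x≡y)
open import Data.Product.Base using (_,_; ∃-syntax; proj₁; proj₂)
open import Data.Sum.Base using (_⊎_; inj₁; inj₂; [_,_])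
open import Data.Vec.Base using (Vec; []; _∷_; lookup)
open import Data.Vec.Membership.Propositional using (_∈_)
open import Data.Vec.Membership.Propositional.Properties using (∈-lookup)
open import Data.Vec.Properties.WithK using ([]=-irrelevant)
open import Data.Vec.Relation.Unary.All using ([]; _∷_)
open import Data.Vec.Relation.Unary.AllPairs using ([]; _∷_)
open import Data.Vec.Relation.Unary.Any using (here; there; index)
open import Data.Vec.Relation.Unary.Any.Properties using (lookup-index)
open import Data.Vec.Relation.Unary.Unique.Propositional using (Unique)
open import Data.Vec.Relation.Unary.Unique.Propositional.Properties
  using (lookup-injective)
open import Function.Base using (_∘_; const)
open import Function.Bundles using (_⇔_; mk⇔; mk↔ₛ′; Equivalence; Injection)
open import Function.Properties.Inverse using (↔⇒↣)
open import Relation.Binary.Definitions using (tri<; tri≈; tri>)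
open import Relation.Binary.PropositionalEquality
  using (_≡_; _≢_; refl; sym; trans; cong; subst; subst₂)
open import Relation.Nullary.Decidable
  using (yes; no; from-yes; ¬?; _→-dec_; decidable-stable)
open import Relation.Nullary.Negation using (¬_; contradiction)

open SimpleGraph

-- Induced subgraphs and graphs on `Fin k`.

member-≡ : ∀ {n} {S : Subset n} {x y : ∃[ v ] v ∈ˢ S} →
           proj₁ x ≡ proj₁ y → x ≡ y
member-≡ {x = v , p} {y = .v , q} refl = cong (v ,_) ([]=-irrelevant p q)

-- Irreflexivity settles the diagonal and symmetry the pairs with `j < i`, so a graph on four
-- vertices needs six comparisons instead of sixteen.
agree-from-< : ∀ {n} {V : Set} (G : SimpleGraph V) (H : SimpleGraph (Fin n))
               (e : Fin n → V) →
               (∀ {i j} → i < j → Adj G (e i) (e j) ⇔ Adj H i j) →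
               ∀ i j → Adj G (e i) (e j) ⇔ Adj H i j
agree-from-< G H e agree i j with <-cmp i j
... | tri< i<j _ _ = agree i<j
... | tri≈ _ refl _ =
  mk⇔ (⊥-elim ∘ irrefl G refl) (⊥-elim ∘ irrefl H refl)
... | tri> _ _ j<i =
  mk⇔ (symm H ∘ Equivalence.to (agree j<i) ∘ symm G)
      (symm G ∘ Equivalence.from (agree j<i) ∘ symm H)

-- A repetition-free enumeration `xs` of `S` is itself the bijection: `lookup` one way, the index of
-- a membership proof the other. Uniqueness makes the index of `lookup xs i` return to `i`.
induced-≅ : ∀ {n k} (K : SimpleGraph (Fin n)) (H : SimpleGraph (Fin k))
            {S : Subset n} {xs : Vec (Fin n) k} → Unique xs →
            (∀ {x} → x ∈ˢ S ⇔ x ∈ xs) →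
            (∀ {i j} → i < j → Adj K (lookup xs i) (lookup xs j) ⇔ Adj H i j) →
            induced K S ≅ H
induced-≅ K H {S} {xs} unique S⇔xs agree = record
  { bijection = mk↔ₛ′ position vertex position-vertex
                  (λ x → member-≡ (lookup-position x))
  ; preserves = λ x y →
      subst₂ (λ u v → Adj K u v ⇔ Adj H (position x) (position y))
             (lookup-position x) (lookup-position y)
             (agree-from-< K H (lookup xs) agree (position x) (position y))
  }
  where
  position : ∃[ v ] v ∈ˢ S → Fin _
  position (_ , v∈S) = index (Equivalence.to S⇔xs v∈S)

  vertex : Fin _ → ∃[ v ] v ∈ˢ S
  vertex i = lookup xs i , Equivalence.from S⇔xs (∈-lookup i xs)

  lookup-position : ∀ x → lookup xs (position x) ≡ proj₁ x
  lookup-position (_ , v∈S) = sym (lookup-index (Equivalence.to S⇔xs v∈S))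

  position-vertex : ∀ i → position (vertex i) ≡ i
  position-vertex i =
    lookup-injective unique (position (vertex i)) i (lookup-position (vertex i))

both : {A B : Set} → A → B → A ⇔ B
both a b = mk⇔ (const b) (const a)

neither : {A B : Set} → ¬ A → ¬ B → A ⇔ B
neither ¬a ¬b = mk⇔ (⊥-elim ∘ ¬a) (⊥-elim ∘ ¬b)

module _ {n} (K : SimpleGraph (Fin n)) {S : Subset n} {a b c d : Fin n} where

  induced-K₄ : Unique (a ∷ b ∷ c ∷ d ∷ []) →
               (∀ {x} → x ∈ˢ S ⇔ x ∈ (a ∷ b ∷ c ∷ d ∷ [])) →
               Adj K a b → Adj K a c → Adj K a d →
               Adj K b c → Adj K b d → Adj K c d →
               induced K S ≅ K₄
  induced-K₄ unique S⇔xs ab ac ad bc bd cd = induced-≅ K K₄ unique S⇔xs agree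
    where
    agree : ∀ {i j} → i < j →
            Adj K (lookup (a ∷ b ∷ c ∷ d ∷ []) i) (lookup (a ∷ b ∷ c ∷ d ∷ []) j)
            ⇔ Adj K₄ i j
    agree {0F} {1F} _ = both ab λ ()
    agree {0F} {2F} _ = both ac λ ()
    agree {0F} {3F} _ = both ad λ ()
    agree {1F} {2F} _ = both bc λ ()
    agree {1F} {3F} _ = both bd λ ()
    agree {2F} {3F} _ = both cd λ ()
    agree {1F} {1F} (s<s ())
    agree {2F} {1F} (s<s ())
    agree {2F} {2F} (s<s (s<s ()))
    agree {3F} {3F} (s<s (s<s (s<s ())))

  -- The list gives the vertices in cyclic order, so a, c and b, d are the diagonals; a caller
  -- chooses the order of enumeration to suit its cycle.
  induced-C₄ : Unique (a ∷ b ∷ c ∷ d ∷ []) →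
               (∀ {x} → x ∈ˢ S ⇔ x ∈ (a ∷ b ∷ c ∷ d ∷ [])) →
               Adj K a b → Adj K b c → Adj K c d → Adj K a d →
               ¬ Adj K a c → ¬ Adj K b d →
               induced K S ≅ C₄
  induced-C₄ unique S⇔xs ab bc cd ad ¬ac ¬bd = induced-≅ K C₄ unique S⇔xs agree
    where
    agree : ∀ {i j} → i < j →
            Adj K (lookup (a ∷ b ∷ c ∷ d ∷ []) i) (lookup (a ∷ b ∷ c ∷ d ∷ []) j)
            ⇔ Adj C₄ i j
    agree {0F} {1F} _ = both ab (inj₁ refl)
    agree {0F} {2F} _ = neither ¬ac [ (λ ()) , (λ ()) ]
    agree {0F} {3F} _ = both ad (inj₂ refl)
    agree {1F} {2F} _ = both bc (inj₁ refl)
    agree {1F} {3F} _ = neither ¬bd [ (λ ()) , (λ ()) ]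
    agree {2F} {3F} _ = both cd (inj₁ refl)
    agree {1F} {1F} (s<s ())
    agree {2F} {1F} (s<s ())
    agree {2F} {2F} (s<s (s<s ()))
    agree {3F} {3F} (s<s (s<s (s<s ())))

∈-∪₄ : ∀ {n} {a b c d x : Fin n} →
       x ∈ˢ (⁅ a ⁆ ∪ ⁅ b ⁆ ∪ ⁅ c ⁆ ∪ ⁅ d ⁆) ⇔ x ∈ (a ∷ b ∷ c ∷ d ∷ [])
∈-∪₄ = mk⇔
  ([ here ∘ ≡⇒ ,
     [ there ∘ here ∘ ≡⇒ ,
       [ there ∘ there ∘ here ∘ ≡⇒ , there ∘ there ∘ there ∘ here ∘ ≡⇒ ]
       ∘ ∪⇒ ] ∘ ∪⇒ ] ∘ ∪⇒)
  (λ where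
    (here p)                         → ∪⇐ (inj₁ (≡⇐ p))
    (there (here p))                 → ∪⇐ (inj₂ (∪⇐ (inj₁ (≡⇐ p))))
    (there (there (here p)))         → ∪⇐ (inj₂ (∪⇐ (inj₂ (∪⇐ (inj₁ (≡⇐ p))))))
    (there (there (there (here p)))) → ∪⇐ (inj₂ (∪⇐ (inj₂ (∪⇐ (inj₂ (≡⇐ p)))))))
  where
  ∪⇒ : ∀ {n x} {p q : Subset n} → x ∈ˢ (p ∪ q) → x ∈ˢ p ⊎ x ∈ˢ q
  ∪⇒ = Equivalence.to ∪⇔⊎
  ∪⇐ : ∀ {n x} {p q : Subset n} → x ∈ˢ p ⊎ x ∈ˢ q → x ∈ˢ (p ∪ q)
  ∪⇐ = Equivalence.from ∪⇔⊎
  ≡⇒ : ∀ {n} {x y : Fin n} → x ∈ˢ ⁅ y ⁆ → x ≡ y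
  ≡⇒ = Equivalence.to x∈⁅y⁆⇔x≡y
  ≡⇐ : ∀ {n} {x y : Fin n} → x ≡ y → x ∈ˢ ⁅ y ⁆
  ≡⇐ = Equivalence.from x∈⁅y⁆⇔x≡y

swap-last-∈ : ∀ {A : Set} {a b c d x : A} →
              x ∈ (a ∷ b ∷ c ∷ d ∷ []) → x ∈ (a ∷ b ∷ d ∷ c ∷ [])
swap-last-∈ (here p)                         = here p
swap-last-∈ (there (here p))                 = there (here p)
swap-last-∈ (there (there (here p)))         = there (there (there (here p)))
swap-last-∈ (there (there (there (here p)))) = there (there (here p))

-- Each vertex lies on the side a, b or on the side c, d. The hypotheses exclude edges across, and
-- without loops an edge within a side must join its two ends.
onlyTwoEdges : ∀ {n} (K : SimpleGraph (Fin n)) {a b c d : Fin n} →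
               Adj K a b → Adj K c d →
               ¬ Adj K a c → ¬ Adj K a d → ¬ Adj K b c → ¬ Adj K b d →
               OnlyTwoEdges K a b c d
onlyTwoEdges K {a} {b} {c} {d} ab cd ¬ac ¬ad ¬bc ¬bd (x , x∈S) (y , y∈S) = mk⇔
  (toSame (side (Equivalence.to ∈-∪₄ x∈S)) (side (Equivalence.to ∈-∪₄ y∈S)))
  [ fromSame ab , fromSame cd ]
  where
  side : ∀ {z} → z ∈ (a ∷ b ∷ c ∷ d ∷ []) → (z ≡ a ⊎ z ≡ b) ⊎ (z ≡ c ⊎ z ≡ d)
  side (here p)                         = inj₁ (inj₁ p)
  side (there (here p))                 = inj₁ (inj₂ p)
  side (there (there (here p)))         = inj₂ (inj₁ p)
  side (there (there (there (here p)))) = inj₂ (inj₂ p)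

  within : ∀ {u v p q} → u ≡ p ⊎ u ≡ q → v ≡ p ⊎ v ≡ q →
           Adj K u v → SameEdge (u , v) (p , q)
  within (inj₁ refl) (inj₁ refl) uv = contradiction uv (irrefl K refl)
  within (inj₁ u≡p)  (inj₂ v≡q)  _  = inj₁ (u≡p , v≡q)
  within (inj₂ u≡q)  (inj₁ v≡p)  _  = inj₂ (u≡q , v≡p)
  within (inj₂ refl) (inj₂ refl) uv = contradiction uv (irrefl K refl)

  across : ∀ {u v} → u ≡ a ⊎ u ≡ b → v ≡ c ⊎ v ≡ d → ¬ Adj K u v
  across (inj₁ refl) (inj₁ refl) = ¬ac
  across (inj₁ refl) (inj₂ refl) = ¬ad
  across (inj₂ refl) (inj₁ refl) = ¬bc
  across (inj₂ refl) (inj₂ refl) = ¬bd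

  toSame : ∀ {u v} →
           (u ≡ a ⊎ u ≡ b) ⊎ (u ≡ c ⊎ u ≡ d) →
           (v ≡ a ⊎ v ≡ b) ⊎ (v ≡ c ⊎ v ≡ d) →
           Adj K u v → SameEdge (u , v) (a , b) ⊎ SameEdge (u , v) (c , d)
  toSame (inj₁ u) (inj₁ v) uv = inj₁ (within u v uv)
  toSame (inj₁ u) (inj₂ v) uv = contradiction uv (across u v)
  toSame (inj₂ u) (inj₁ v) uv = contradiction (symm K uv) (across v u)
  toSame (inj₂ u) (inj₂ v) uv = inj₂ (within u v uv)

  fromSame : ∀ {u v p q} → Adj K p q → SameEdge (u , v) (p , q) → Adj K u v
  fromSame pq (inj₁ (refl , refl)) = pq
  fromSame pq (inj₂ (refl , refl)) = symm K pq

-- Involutions that send every vertex to a neighbour.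

module _ {A : Set} {f : A → A} (f-involutive : ∀ x → f (f x) ≡ x) where

  involution-adjoint : ∀ {x y} → f x ≡ y → x ≡ f y
  involution-adjoint {x} fx≡y = trans (sym (f-involutive x)) (cong f fx≡y)

  involution-injective : ∀ {x y} → f x ≡ f y → x ≡ y
  involution-injective {y = y} fx≡fy = trans (involution-adjoint fx≡fy) (f-involutive y)

module _ {n} (K : SimpleGraph (Fin n)) {f : Fin n → Fin n}
         (f-involutive : ∀ v → f (f v) ≡ v)
         (f-edge : ∀ v → Adj K v (f v))
         (f-preserves : ∀ {u v} → Adj K u v → Adj K (f u) (f v)) where

  -- Applying `f` once more undoes it. Stated for an arbitrary involution, this serves the given
  -- opposition in one direction and `mate` in the other.
  f-reflects : ∀ {u v} → Adj K (f u) (f v) → Adj K u v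
  f-reflects {u} {v} =
    subst₂ (Adj K) (f-involutive u) (f-involutive v) ∘ f-preserves

  f-shift : ∀ {u v} → Adj K u (f v) → Adj K (f u) v
  f-shift {v = v} = subst (Adj K _) (f-involutive v) ∘ f-preserves

  f-unshift : ∀ {u v} → Adj K (f u) v → Adj K u (f v)
  f-unshift {u} = subst (λ x → Adj K x _) (f-involutive u) ∘ f-preserves

  -- f v is passed as a variable w so that v and f v can exchange roles.
  quadruple-unique : ∀ {u v w} → f v ≡ w → u ≢ v → u ≢ w →
                     Unique (u ∷ f u ∷ v ∷ w ∷ [])
  quadruple-unique {u} {v} refl u≢v u≢w =
    (f-moves u ∷ u≢v ∷ u≢w ∷ [])
    ∷ (u≢w ∘ involution-adjoint f-involutive ∷ u≢v ∘ involution-injective f-involutive ∷ [])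
    ∷ (f-moves v ∷ [])
    ∷ []
    ∷ []
    where
    f-moves : ∀ x → x ≢ f x
    f-moves x x≡fx = irrefl K x≡fx (f-edge x)

  -- The four cross pairs form two orbits under `f`, represented by u, v and u, f v; testing these
  -- two settles all four.
  involution-pairs : ∀ u v → u ≢ v → u ≢ f v →
    inducedBy4 K u (f u) v (f v) ≅ K₄
    ⊎ inducedBy4 K u (f u) v (f v) ≅ C₄
    ⊎ OnlyTwoEdges K u (f u) v (f v)
  involution-pairs u v u≢v u≢fv with adj? K u v | adj? K u (f v)
  ... | yes uv | yes ufv = inj₁
    (induced-K₄ K (quadruple-unique refl u≢v u≢fv) ∈-∪₄
      (f-edge u) uv ufv (f-shift ufv) (f-preserves uv) (f-edge v))
  ... | yes uv | no ¬ufv = inj₂ (inj₁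
    -- The cycle runs u, f u, f v, v, so the last two vertices of the enumeration are exchanged.
    (induced-C₄ K (quadruple-unique (f-involutive v) u≢fv u≢v)
      (mk⇔ (swap-last-∈ ∘ Equivalence.to ∈-∪₄) (Equivalence.from ∈-∪₄ ∘ swap-last-∈))
      (f-edge u) (f-preserves uv) (symm K (f-edge v)) uv ¬ufv (¬ufv ∘ f-unshift)))
  ... | no ¬uv | yes ufv = inj₂ (inj₁
    (induced-C₄ K (quadruple-unique refl u≢v u≢fv) ∈-∪₄
      (f-edge u) (f-shift ufv) (f-edge v) ufv ¬uv (¬uv ∘ f-reflects)))
  ... | no ¬uv | no ¬ufv = inj₂ (inj₂
    (onlyTwoEdges K (f-edge u) (f-edge v) ¬uv ¬ufv (¬ufv ∘ f-unshift) (¬uv ∘ f-reflects)))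

-- From an opposition to an opposition matching.

opposition⇒matching : ∀ {n} (G : SimpleGraph (Fin n)) →
                      HasOpposition G → HasOppositionMatching (complement G)
opposition⇒matching G (φ , opp) = (λ u v → f u ≡ v) , record
  { isPerfectMatching = record
    { symmetric = λ { refl → involutive _ }
    ; edges     = λ { refl → f-edge _ }
    ; matched   = λ v → f v , refl , λ fv≡w → fv≡w
    }
  ; pairs = λ { u _ v _ refl refl distinct →
      involution-pairs (complement G) involutive f-edge f-preserves u v
        (λ { refl → distinct (inj₁ (refl , refl)) })
        (λ { refl → distinct (inj₂ (refl , involutive v)) }) }
  }
  where
  open _≅_ φ using (preserves) renaming (to to f)
  open IsOpposition opp

  f-edge : ∀ v → Adj (complement G) v (f v)
  f-edge v = (λ v≡fv → opposed v (inj₁ (sym v≡fv))) , opposed v ∘ inj₂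

  f-preserves : ∀ {u v} → Adj (complement G) u v → Adj (complement G) (f u) (f v)
  -- Non-adjacency in `G` passes to the images because the automorphism also reflects adjacency.
  f-preserves {u} {v} (u≢v , ¬uv) =
    u≢v ∘ involution-injective involutive , ¬uv ∘ Equivalence.from (preserves u v)

-- From an opposition matching to an opposition.

-- Adjacency in `C₄` means opposite parity. Thus j and k are the two vertices of one parity, i and l
-- those of the other, and j, l are adjacent. The proof decides all 256 cases.
C₄-opposite : ∀ i j k l → Adj C₄ i j → Adj C₄ k l → i ≢ l → j ≢ k →
              Adj C₄ i k → Adj C₄ j l
C₄-opposite = from-yes (all? λ i → all? λ j → all? λ k → all? λ l →
  adj? C₄ i j →-dec adj? C₄ k l →-dec ¬? (i ≟ l) →-dec ¬? (j ≟ k) →-dec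
  adj? C₄ i k →-dec adj? C₄ j l)

module _ {n} (K : SimpleGraph (Fin n)) (M : Fin n → Fin n → Set)
         (opp : IsOppositionMatching K M) where

  open IsOppositionMatching opp
  open IsPerfectMatching isPerfectMatching

  mate : Fin n → Fin n
  mate v = proj₁ (matched v)

  mate-matched : ∀ v → M v (mate v)
  mate-matched v = proj₁ (proj₂ (matched v))

  mate-unique : ∀ {v w} → M v w → mate v ≡ w
  mate-unique {v} = proj₂ (proj₂ (matched v))

  mate-involutive : ∀ v → mate (mate v) ≡ v
  mate-involutive v = mate-unique (symmetric (mate-matched v))

  mate-edge : ∀ v → Adj K v (mate v)
  mate-edge v = edges (mate-matched v)

  -- The edge uv crosses between two matching edges; each allowed shape of the induced subgraph
  -- either forces the opposite cross edge or rules out uv.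
  mate-preserves : ∀ {u v} → Adj K u v → Adj K (mate u) (mate v)
  mate-preserves {u} {v} uv with mate u ≟ v
  -- Here uv is itself a matching edge, and `mate` merely reverses it.
  ... | yes refl = subst (Adj K (mate u)) (sym (mate-involutive u)) (symm K uv)
  ... | no mu≢v = [ via-K₄ , [ via-C₄ , via-two-edges ] ]
                  (pairs u (mate u) v (mate v) (mate-matched u) (mate-matched v) distinct)
    where
    u≢v : u ≢ v
    u≢v u≡v = irrefl K u≡v uv

    mu≢mv : mate u ≢ mate v
    mu≢mv = u≢v ∘ involution-injective mate-involutive

    u≢mv : u ≢ mate v
    u≢mv = mu≢v ∘ sym ∘ involution-adjoint mate-involutive ∘ sym

    distinct : ¬ SameEdge (u , mate u) (v , mate v)
    distinct (inj₁ (u≡v , _))  = u≢v u≡v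
    distinct (inj₂ (u≡mv , _)) = u≢mv u≡mv

    H = inducedBy4 K u (mate u) v (mate v)

    a b c d : ∃[ x ] x ∈ˢ (⁅ u ⁆ ∪ ⁅ mate u ⁆ ∪ ⁅ v ⁆ ∪ ⁅ mate v ⁆)
    a = u      , Equivalence.from ∈-∪₄ (here refl)
    b = mate u , Equivalence.from ∈-∪₄ (there (here refl))
    c = v      , Equivalence.from ∈-∪₄ (there (there (here refl)))
    d = mate v , Equivalence.from ∈-∪₄ (there (there (there (here refl))))

    module _ {W : Set} {F : SimpleGraph W} (φ : H ≅ F) where
      open _≅_ φ

      to-≢ : ∀ {x y} → proj₁ x ≢ proj₁ y → to x ≢ to y
      to-≢ x≢y e = x≢y (cong proj₁ (Injection.injective (↔⇒↣ bijection) e))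

    via-K₄ : H ≅ K₄ → Adj K (mate u) (mate v)
    via-K₄ φ = Equivalence.from (preserves b d) (to-≢ φ {b} {d} mu≢mv)
      where open _≅_ φ

    via-C₄ : H ≅ C₄ → Adj K (mate u) (mate v)
    via-C₄ φ = Equivalence.from (preserves b d)
      (C₄-opposite (to a) (to b) (to c) (to d)
        (Equivalence.to (preserves a b) (mate-edge u))
        (Equivalence.to (preserves c d) (mate-edge v))
        (to-≢ φ {a} {d} u≢mv) (to-≢ φ {b} {c} mu≢v)
        (Equivalence.to (preserves a c) uv))
      where open _≅_ φ

    -- This shape cannot occur: uv would have to be one of the two matching edges, but v is not the
    -- mate of u.
    via-two-edges : OnlyTwoEdges K u (mate u) v (mate v) → Adj K (mate u) (mate v)
    via-two-edges only with Equivalence.to (only a c) uv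
    ... | inj₁ (inj₁ (_ , v≡mu))  = contradiction (sym v≡mu) mu≢v
    ... | inj₁ (inj₂ (u≡mu , _))  = contradiction (mate-edge u) (irrefl K u≡mu)
    ... | inj₂ (inj₁ (u≡v , _))   = contradiction u≡v u≢v
    ... | inj₂ (inj₂ (u≡mv , _))  = contradiction u≡mv u≢mv

matching⇒opposition : ∀ {n} (G : SimpleGraph (Fin n)) →
                      HasOppositionMatching (complement G) → HasOpposition G
matching⇒opposition {n} G (M , opp) = record
  { bijection = mk↔ₛ′ f f f-involutive f-involutive
  -- Since `f` is an involution, preserving adjacency already gives the converse.
  ; preserves = λ u v → mk⇔ f-preserves
      (subst₂ (Adj G) (f-involutive u) (f-involutive v) ∘ f-preserves)
  } , record
  { involutive = f-involutive
  ; opposed    = λ v → [ proj₁ (f-edge v) ∘ sym , proj₂ (f-edge v) ]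
  }
  where
  f : Fin n → Fin n
  f = mate (complement G) M opp

  f-involutive : ∀ v → f (f v) ≡ v
  f-involutive = mate-involutive (complement G) M opp

  f-edge : ∀ v → Adj (complement G) v (f v)
  f-edge = mate-edge (complement G) M opp

  f-preserves : ∀ {u v} → Adj G u v → Adj G (f u) (f v)
  -- Were f u and f v non-adjacent in `G`, they would be adjacent in the complement, hence so would
  -- u and v. Decidable adjacency removes the double negation.
  f-preserves {u} {v} uv = decidable-stable (adj? G (f u) (f v)) λ ¬fufv →
    proj₂ (f-reflects (complement G) f-involutive f-edge
             (mate-preserves (complement G) M opp) (fu≢fv , ¬fufv)) uv
    where
    fu≢fv : f u ≢ f v
    fu≢fv e = irrefl G (involution-injective f-involutive e) uv

theorem2p3 : (n : ℕ) (G : SimpleGraph (Fin n)) → HasOpposition G ⇔ HasOppositionMatching (complement G)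
theorem2p3 n G = mk⇔ (opposition⇒matching G) (matching⇒opposition G)
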